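{- Let $G_1$ and $G_2$ be simple graphs on $n$ vertices with respective maximum degrees $\Delta_1$ and $\Delta_2$, where $\Delta_1 \ge \Delta_2$, such that $(\Delta_1+1)(\Delta_2+1) \le n+1$. Suppose that neither $G_1$ nor $G_2$ contains a cycle of length $4$, $6$ or $8$ as a subgraph, and that either $\Delta_1 \ge 940060$ or $\Delta_1 \ge \Delta_2 \ge 27620$. Then $G_1$ and $G_2$ pack.
   Context: Two graphs $G_1$ and $G_2$ on $n$ vertices pack if there exist injective maps of $V(G_1)$ and $V(G_2)$ into $\{1,\dots,n\}$ such that the images of $E(G_1)$ and $E(G_2)$ are disjoint; equivalently, $G_1$ is isomorphic to a subgraph of the complement of $G_2$. The paper assumes throughout, without loss of generality, that $\Delta_1 \ge \Delta_2$ (the hypotheses and conclusion are symmetric in the two graphs apart from this naming). -}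

module Defs where

open import Data.Nat using (ℕ; zero; suc; _+_; _⊔_)
open import Data.Bool using (Bool; true; false; if_then_else_)
open import Data.Fin using (Fin; zero; suc; toℕ)
open import Data.Product using (Σ; _×_; ∃-syntax)
open import Data.Sum using (_⊎_)
open import Relation.Binary.PropositionalEquality using (_≡_)
open import Relation.Nullary using (¬_)
open import Function.Definitions using (Injective)

record Graph (n : ℕ) : Set where
  field
    adj       : Fin n → Fin n → Bool
    symmetric : ∀ u v → adj u v ≡ adj v u
    loopless  : ∀ v → adj v v ≡ false
open Graph public

sumFin : ∀ {m} → (Fin m → ℕ) → ℕ
sumFin {zero}  f = 0
sumFin {suc m} f = f zero + sumFin (λ i → f (suc i))

maxFin : ∀ {m} → (Fin m → ℕ) → ℕ
maxFin {zero}  f = 0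
maxFin {suc m} f = f zero ⊔ maxFin (λ i → f (suc i))

degree : ∀ {n} → Graph n → Fin n → ℕ
degree G v = sumFin (λ w → if adj G v w then 1 else 0)

maxDegree : ∀ {n} → Graph n → ℕ
maxDegree G = maxFin (degree G)

ContainsCycle : ∀ {n} → Graph n → ℕ → Set
ContainsCycle {n} G k =
  Σ (Fin k → Fin n) λ c →
    Injective _≡_ _≡_ c ×
    (∀ (i j : Fin k) →
      (suc (toℕ i) ≡ toℕ j ⊎ (suc (toℕ i) ≡ k × toℕ j ≡ 0)) →
      adj G (c i) (c j) ≡ true)

Pack : ∀ {n} → Graph n → Graph n → Set
Pack {n} G₁ G₂ =
  Σ (Fin n → Fin n) λ f → Σ (Fin n → Fin n) λ g →
    Injective _≡_ _≡_ f × Injective _≡_ _≡_ g ×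
    (∀ u v x y → adj G₁ u v ≡ true → adj G₂ x y ≡ true →
      ¬ (f u ≡ g x × f v ≡ g y))

{-# OPTIONS --safe #-}

-- A graph of minimum degree greater than d without 4- and 6-cycles has at least
-- (d + 1) d (d - 1) vertices, so either n is much larger than Δ₁² or the vertices of G₁
-- can be inserted one at a time, each with at most Δ₁ / 4 neighbours already present.
-- When u is inserted, its conflicts with G₂ are removed by a rotation u ↦ x ↦ y ↦ u.
-- Write N₁, N₂ for the neighbourhoods in G₁ and in the pulled back G₂.  There are two
-- admissible choices y, y′, and a choice of x outside N₂(N₁(u)) and a few more vertices
-- works for y unless x ∈ N₁(N₂(y)).  Apart from the at most Δ₁ vertices adjacent to a
-- common element of N₂(y) and N₂(y′), the vertices in N₁(N₂(y)) ∩ N₁(N₂(y′)) fall into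
-- classes N₁(p), p ∈ N₂(y); each injects into N₂(y′), and two of the images share at most
-- one element, for otherwise G₁ has a cycle of length 4, 6 or 8.  Hence there are only
-- about Δ₂² / 2 of them, too few to block every x.
module Submission where

open import Defs
open import Data.Nat using (ℕ; zero; suc; _+_; _*_; _∸_; _≤_; _<_; _≥_; z≤n; s≤s)
open import Data.Nat.Properties hiding (_≟_)
open import Data.Nat.DivMod using (_/_; _%_; m≡m%n+[m/n]*n; m%n<n; m/n*n≤m; /-monoˡ-≤)
open import Data.Nat.Tactic.RingSolver using (solve-∀)
open import Data.Bool as Bool using (Bool; true; false; _∧_; if_then_else_)
open import Data.Bool.Properties using (∧-comm)
open import Data.Empty using (⊥; ⊥-elim)
open import Data.Fin using (Fin; zero; suc; toℕ; fromℕ)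
open import Data.Fin.Properties using (_≟_; toℕ-injective; toℕ-fromℕ; ¬∀⟶∃¬)
open import Data.List using (List; []; _∷_; _++_; length; filter; concatMap; allFin; tabulate)
open import Data.List.Properties using (length-++; length-filter; length-tabulate; filter-notAll)
open import Data.List.Membership.Propositional using (_∈_; _∉_; find; lose)
open import Data.List.Membership.Propositional.Properties
open import Data.List.Relation.Unary.All as All using ([]; _∷_)
open import Data.List.Relation.Unary.AllPairs using ([]; _∷_)
open import Data.List.Relation.Unary.Any using (Any; here; there; any?)
open import Data.List.Relation.Unary.Unique.Propositional using (Unique)
import Data.List.Relation.Unary.Unique.Propositional.Properties as Uniqueₚ
open import Data.Product using (∃; _×_; _,_; proj₁; proj₂)
open import Data.Sum as Sum using (_⊎_; inj₁; inj₂)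
open import Data.Vec using (Vec; []; _∷_; lookup)
open import Data.Vec.Relation.Unary.All using ([]; _∷_)
open import Data.Vec.Relation.Unary.AllPairs using ([]; _∷_)
open import Data.Vec.Relation.Unary.Linked using (Linked; [-]; _∷_)
import Data.Vec.Relation.Unary.Unique.Propositional as Vecᵤ
import Data.Vec.Relation.Unary.Unique.Propositional.Properties as Vecᵤₚ
open import Function using (_∘_; id)
open import Function.Definitions using (Injective)
open import Relation.Binary.PropositionalEquality
open import Relation.Nullary using (¬_; Dec; yes; no; does; contradiction)
open import Relation.Nullary.Decidable using (¬?; _×-dec_; dec-true)
open import Relation.Unary using (Decidable)

-- Lists of vertices

_∈?_ : ∀ {n} (v : Fin n) xs → Dec (v ∈ xs)
v ∈? xs = any? (v ≟_) xs

-- Each step of the induction deletes `f x` from `ys`, which shortens `ys` strictly because `f x`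
-- occurs in it. Injectivity is asked for on members of `xs` alone, since the map `π` below is
-- injective merely within a class.
length-injective-≤ : ∀ {m n} (f : Fin m → Fin n) {xs ys} → Unique xs →
  (∀ {x} → x ∈ xs → f x ∈ ys) →
  (∀ {x x′} → x ∈ xs → x′ ∈ xs → f x ≡ f x′ → x ≡ x′) →
  length xs ≤ length ys
length-injective-≤ f {[]} _ _ _ = z≤n
length-injective-≤ f {x ∷ xs} {ys} (x∉ ∷ u) f∈ inj =
  ≤-trans (s≤s (length-injective-≤ f u f∈′ (λ p q → inj (there p) (there q))))
    (filter-notAll ≢fx? ys (lose (f∈ (here refl)) (λ ne → ne refl)))
  where
  ≢fx? : Decidable (_≢ f x)
  ≢fx? y = ¬? (y ≟ f x)
  f∈′ : ∀ {x′} → x′ ∈ xs → f x′ ∈ filter ≢fx? ys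
  f∈′ x′∈ = ∈-filter⁺ ≢fx? (f∈ (there x′∈))
    λ eq → All.lookup x∉ x′∈ (sym (inj (there x′∈) (here refl) eq))

length-unique-≤ : ∀ {n} {xs ys : List (Fin n)} → Unique xs →
  (∀ {x} → x ∈ xs → x ∈ ys) → length xs ≤ length ys
length-unique-≤ u sub = length-injective-≤ id u sub (λ _ _ → id)

avoid : ∀ {n} (xs : List (Fin n)) → length xs < n → ∃ λ v → v ∉ xs
avoid {n} xs short = ¬∀⟶∃¬ n (_∈ xs) (_∈? xs) λ all →
  <⇒≱ short (subst (_≤ length xs) (length-tabulate id)
    (length-unique-≤ (Uniqueₚ.allFin⁺ n) (λ {x} _ → all x)))

length-constant-≤1 : ∀ {A : Set} {xs : List A} → Unique xs →
  (∀ {x y} → x ∈ xs → y ∈ xs → x ≡ y) → length xs ≤ 1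
length-constant-≤1 {xs = []} _ _ = z≤n
length-constant-≤1 {xs = x ∷ []} _ _ = s≤s z≤n
length-constant-≤1 {xs = x ∷ y ∷ xs} ((x≢y ∷ _) ∷ _) eq =
  contradiction (eq (here refl) (there (here refl))) x≢y

length-filter-split : ∀ {A : Set} {P : A → Set} (P? : Decidable P) xs →
  length (filter P? xs) + length (filter (¬? ∘ P?) xs) ≡ length xs
length-filter-split P? [] = refl
length-filter-split P? (x ∷ xs) with P? x
... | yes _ = cong suc (length-filter-split P? xs)
... | no _ = trans (+-suc _ _) (cong suc (length-filter-split P? xs))

∈-concatMap : ∀ {A B : Set} (f : A → List B) {x xs y} →
  x ∈ xs → y ∈ f x → y ∈ concatMap f xs
∈-concatMap f x∈ y∈ = ∈-concatMap⁺ f (lose x∈ y∈)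

length-concatMap-≤ : ∀ {A B : Set} (f : A → List B) xs {k} →
  (∀ {x} → x ∈ xs → length (f x) ≤ k) → length (concatMap f xs) ≤ length xs * k
length-concatMap-≤ f [] _ = z≤n
length-concatMap-≤ f (x ∷ xs) bound =
  ≤-trans (≤-reflexive (length-++ (f x)))
    (+-mono-≤ (bound (here refl)) (length-concatMap-≤ f xs (bound ∘ there)))

length-concatMap-≥ : ∀ {A B : Set} (f : A → List B) xs {k} →
  (∀ {x} → x ∈ xs → k ≤ length (f x)) → length xs * k ≤ length (concatMap f xs)
length-concatMap-≥ f [] _ = z≤n
length-concatMap-≥ f (x ∷ xs) bound =
  ≤-trans (+-mono-≤ (bound (here refl)) (length-concatMap-≥ f xs (bound ∘ there)))
    (≤-reflexive (sym (length-++ (f x))))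

concatMap-unique : ∀ {A B : Set} (f : A → List B) {xs} → Unique xs →
  (∀ {x} → x ∈ xs → Unique (f x)) →
  (∀ {x x′ y} → x ∈ xs → x′ ∈ xs → y ∈ f x → y ∈ f x′ → x ≡ x′) →
  Unique (concatMap f xs)
concatMap-unique f {[]} _ _ _ = []
concatMap-unique f {x ∷ xs} (x∉ ∷ u) uf disj =
  Uniqueₚ.++⁺ (uf (here refl))
    (concatMap-unique f u (uf ∘ there) (λ p q → disj (there p) (there q)))
    λ (y∈fx , y∈rest) → let _ , x′∈ , y∈fx′ = find (∈-concatMap⁻ f y∈rest) in
      All.lookup x∉ x′∈ (disj (here refl) (there x′∈) y∈fx y∈fx′)

-- Pairing up consecutive entries saves a factor of two over length-concatMap-≤.
length-concatMap-pairs-≤ : ∀ {A B : Set} (f : A → List B) b {xs} → Unique xs →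
  (∀ {x} → x ∈ xs → length (f x) ≤ b) →
  (∀ {x y} → x ∈ xs → y ∈ xs → x ≢ y → length (f x) + length (f y) ≤ suc b) →
  2 * length (concatMap f xs) ≤ length xs * suc b + b
length-concatMap-pairs-≤ f b {[]} _ _ _ = z≤n
length-concatMap-pairs-≤ f b {x ∷ []} _ single _ = begin
  2 * length (f x ++ [])        ≡⟨ cong (2 *_) (trans (length-++ (f x)) (+-identityʳ _)) ⟩
  2 * length (f x)              ≤⟨ *-monoʳ-≤ 2 (single (here refl)) ⟩
  b + (b + 0)                   ≡⟨ cong (b +_) (+-identityʳ b) ⟩
  b + b                         ≤⟨ +-monoˡ-≤ b (n≤1+n b) ⟩
  suc b + b                     ≡⟨ cong (_+ b) (sym (+-identityʳ (suc b))) ⟩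
  suc b + 0 + b                 ∎
  where open ≤-Reasoning
length-concatMap-pairs-≤ f b {x ∷ y ∷ xs} ((x≢y ∷ _) ∷ _ ∷ u) single pair = begin
  2 * length (f x ++ f y ++ concatMap f xs)
    ≡⟨ cong (2 *_) (trans (length-++ (f x)) (cong (length (f x) +_) (length-++ (f y)))) ⟩
  2 * (length (f x) + (length (f y) + length (concatMap f xs)))
    ≡⟨ regroup (length (f x)) (length (f y)) (length (concatMap f xs)) ⟩
  2 * (length (f x) + length (f y)) + 2 * length (concatMap f xs)
    ≤⟨ +-mono-≤ (*-monoʳ-≤ 2 (pair (here refl) (there (here refl)) x≢y))
         (length-concatMap-pairs-≤ f b u (single ∘ there ∘ there)
           (λ p q → pair (there (there p)) (there (there q)))) ⟩
  2 * suc b + (length xs * suc b + b)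
    ≡⟨ regroup′ (length xs * suc b) b ⟩
  suc b + (suc b + length xs * suc b) + b ∎
  where
  open ≤-Reasoning
  regroup : ∀ p q r → 2 * (p + (q + r)) ≡ 2 * (p + q) + 2 * r
  regroup = solve-∀
  regroup′ : ∀ l b → 2 * suc b + (l + b) ≡ suc b + (suc b + l) + b
  regroup′ = solve-∀

-- Neighbourhoods and short cycles

Edge : ∀ {n} → Graph n → Fin n → Fin n → Set
Edge G u v = adj G u v ≡ true

edge? : ∀ {n} (G : Graph n) u v → Dec (Edge G u v)
edge? G u v = adj G u v Bool.≟ true

edge-sym : ∀ {n} (G : Graph n) {u v} → Edge G u v → Edge G v u
edge-sym G {u} {v} e = trans (symmetric G v u) e

edge⇒≢ : ∀ {n} (G : Graph n) {u v} → Edge G u v → u ≢ v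
edge⇒≢ G {u} e refl with trans (sym e) (loopless G u)
... | ()

nbrs : ∀ {n} → Graph n → Fin n → List (Fin n)
nbrs G v = filter (edge? G v) (allFin _)

∈-nbrs⁺ : ∀ {n} (G : Graph n) {v w} → Edge G v w → w ∈ nbrs G v
∈-nbrs⁺ G {v} {w} = ∈-filter⁺ (edge? G v) (∈-allFin w)

∈-nbrs⁻ : ∀ {n} (G : Graph n) {v w} → w ∈ nbrs G v → Edge G v w
∈-nbrs⁻ G {v} w∈ = proj₂ (∈-filter⁻ (edge? G v) {xs = allFin _} w∈)

nbrs-unique : ∀ {n} (G : Graph n) v → Unique (nbrs G v)
nbrs-unique {n} G v = Uniqueₚ.filter⁺ (edge? G v) (Uniqueₚ.allFin⁺ n)

-- An arbitrary `f` lets the induction pass to `f ∘ suc`. With `f = id` this identifies the length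
-- of `nbrs` with `degree`.
length-filter-tabulate : ∀ {m n} (f : Fin m → Fin n) (P : Fin n → Bool) →
  length (filter (λ w → P w Bool.≟ true) (tabulate f)) ≡ sumFin (λ i → if P (f i) then 1 else 0)
length-filter-tabulate {zero} f P = refl
length-filter-tabulate {suc m} f P with P (f zero)
... | true  = cong suc (length-filter-tabulate (f ∘ suc) P)
... | false = length-filter-tabulate (f ∘ suc) P

≤-maxFin : ∀ {m} (f : Fin m → ℕ) i → f i ≤ maxFin f
≤-maxFin f zero = m≤m⊔n _ _
≤-maxFin f (suc i) = ≤-trans (≤-maxFin (f ∘ suc) i) (m≤n⊔m _ _)

length-nbrs-≤ : ∀ {n} (G : Graph n) v → length (nbrs G v) ≤ maxDegree G
length-nbrs-≤ G v = subst (_≤ maxDegree G) (sym (length-filter-tabulate id (adj G v)))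
  (≤-maxFin (degree G) v)

linked-lookup : ∀ {A : Set} {R : A → A → Set} {k} {v : Vec A k} → Linked R v →
  ∀ i j → suc (toℕ i) ≡ toℕ j → R (lookup v i) (lookup v j)
linked-lookup (_∷_ {xs = _ ∷ _} r _) zero (suc zero) _ = r
linked-lookup (_ ∷ l) (suc i) (suc j) eq = linked-lookup l i j (suc-injective eq)

-- Writing a cycle as a vector turns its distinctness and adjacency conditions into explicit lists
-- of proofs; the edge from the last entry back to the first is given separately.
closed-walk⇒cycle : ∀ {n k} (G : Graph n) (v : Vec (Fin n) (suc k)) → Vecᵤ.Unique v →
  Linked (Edge G) v → Edge G (lookup v (fromℕ k)) (lookup v zero) → ContainsCycle G (suc k)
closed-walk⇒cycle {k = k} G v u l close = lookup v , (λ {i} {j} → Vecᵤₚ.lookup-injective u i j) , adjacent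
  where
  adjacent : ∀ i j → suc (toℕ i) ≡ toℕ j ⊎ (suc (toℕ i) ≡ suc k × toℕ j ≡ 0) →
    Edge G (lookup v i) (lookup v j)
  adjacent i j (inj₁ eq) = linked-lookup l i j eq
  adjacent i j (inj₂ (last , first))
    with toℕ-injective {i = i} {fromℕ k} (trans (suc-injective last) (sym (toℕ-fromℕ k)))
       | toℕ-injective {i = j} {zero} first
  ... | refl | refl = close

-- Two distinct common neighbours x, y would close the 4-cycle p, x, q, y.
common-nbr-unique : ∀ {n} (G : Graph n) → ¬ ContainsCycle G 4 → ∀ {p q x y} → p ≢ q →
  Edge G p x → Edge G p y → Edge G q x → Edge G q y → x ≡ y
common-nbr-unique G noC4 {p} {q} {x} {y} p≢q px py qx qy with x ≟ y
... | yes x≡y = x≡y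
... | no x≢y = ⊥-elim (noC4 (closed-walk⇒cycle G (p ∷ x ∷ q ∷ y ∷ [])
  ((edge⇒≢ G px ∷ p≢q ∷ edge⇒≢ G py ∷ []) ∷
   (edge⇒≢ G (edge-sym G qx) ∷ x≢y ∷ []) ∷ (edge⇒≢ G qy ∷ []) ∷ [] ∷ [])
  (px ∷ edge-sym G qx ∷ qy ∷ [-]) (edge-sym G py)))

-- Consecutive vertices differ because they are adjacent, so nine inequalities remain: three among
-- the p's, three among the x's and three between opposite vertices.
no-hexagon : ∀ {n} (G : Graph n) → ¬ ContainsCycle G 6 → ∀ {p₁ x₁ p₂ x₂ p₃ x₃} →
  Edge G p₁ x₁ → Edge G x₁ p₂ → Edge G p₂ x₂ → Edge G x₂ p₃ → Edge G p₃ x₃ → Edge G x₃ p₁ →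
  p₁ ≢ p₂ → p₁ ≢ p₃ → p₂ ≢ p₃ → x₁ ≢ x₂ → x₁ ≢ x₃ → x₂ ≢ x₃ →
  p₁ ≢ x₂ → p₂ ≢ x₃ → p₃ ≢ x₁ → ⊥
no-hexagon G noC6 e₁ e₂ e₃ e₄ e₅ e₆ p₁₂ p₁₃ p₂₃ x₁₂ x₁₃ x₂₃ o₁ o₂ o₃ =
  noC6 (closed-walk⇒cycle G (_ ∷ _ ∷ _ ∷ _ ∷ _ ∷ _ ∷ [])
  ((edge⇒≢ G e₁ ∷ p₁₂ ∷ o₁ ∷ p₁₃ ∷ edge⇒≢ G e₆ ∘ sym ∷ []) ∷
   (edge⇒≢ G e₂ ∷ x₁₂ ∷ o₃ ∘ sym ∷ x₁₃ ∷ []) ∷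
   (edge⇒≢ G e₃ ∷ p₂₃ ∷ o₂ ∷ []) ∷
   (edge⇒≢ G e₄ ∷ x₂₃ ∷ []) ∷ (edge⇒≢ G e₅ ∷ []) ∷ [] ∷ [])
  (e₁ ∷ e₂ ∷ e₃ ∷ e₄ ∷ e₅ ∷ [-]) e₆)

-- The predicate `P` separates the p's from the x's and so settles all sixteen mixed inequalities at
-- once; the other twelve are passed explicitly.
no-octagon : ∀ {n} (G : Graph n) → ¬ ContainsCycle G 8 → (P : Fin n → Set) →
  ∀ {p₁ x₁ p₂ x₂ p₃ x₃ p₄ x₄} →
  Edge G p₁ x₁ → Edge G x₁ p₂ → Edge G p₂ x₂ → Edge G x₂ p₃ →
  Edge G p₃ x₃ → Edge G x₃ p₄ → Edge G p₄ x₄ → Edge G x₄ p₁ →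
  P p₁ → P p₂ → P p₃ → P p₄ → ¬ P x₁ → ¬ P x₂ → ¬ P x₃ → ¬ P x₄ →
  p₁ ≢ p₂ → p₁ ≢ p₃ → p₁ ≢ p₄ → p₂ ≢ p₃ → p₂ ≢ p₄ → p₃ ≢ p₄ →
  x₁ ≢ x₂ → x₁ ≢ x₃ → x₁ ≢ x₄ → x₂ ≢ x₃ → x₂ ≢ x₄ → x₃ ≢ x₄ → ⊥
no-octagon G noC8 P e₁ e₂ e₃ e₄ e₅ e₆ e₇ e₈ P₁ P₂ P₃ P₄ X₁ X₂ X₃ X₄
    p₁₂ p₁₃ p₁₄ p₂₃ p₂₄ p₃₄ x₁₂ x₁₃ x₁₄ x₂₃ x₂₄ x₃₄ =
  noC8 (closed-walk⇒cycle G (_ ∷ _ ∷ _ ∷ _ ∷ _ ∷ _ ∷ _ ∷ _ ∷ [])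
  ((px P₁ X₁ ∷ p₁₂ ∷ px P₁ X₂ ∷ p₁₃ ∷ px P₁ X₃ ∷ p₁₄ ∷ px P₁ X₄ ∷ []) ∷
   (xp X₁ P₂ ∷ x₁₂ ∷ xp X₁ P₃ ∷ x₁₃ ∷ xp X₁ P₄ ∷ x₁₄ ∷ []) ∷
   (px P₂ X₂ ∷ p₂₃ ∷ px P₂ X₃ ∷ p₂₄ ∷ px P₂ X₄ ∷ []) ∷
   (xp X₂ P₃ ∷ x₂₃ ∷ xp X₂ P₄ ∷ x₂₄ ∷ []) ∷
   (px P₃ X₃ ∷ p₃₄ ∷ px P₃ X₄ ∷ []) ∷
   (xp X₃ P₄ ∷ x₃₄ ∷ []) ∷ (px P₄ X₄ ∷ []) ∷ [] ∷ [])
  (e₁ ∷ e₂ ∷ e₃ ∷ e₄ ∷ e₅ ∷ e₆ ∷ e₇ ∷ [-]) e₈)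
  where
  px : ∀ {p x} → P p → ¬ P x → p ≢ x
  px Pp ¬Px refl = ¬Px Pp
  xp : ∀ {p x} → ¬ P x → P p → x ≢ p
  xp ¬Px Pp refl = ¬Px Pp
-- Degeneracy

-- The end points of the walks r, q, w, z counted here are distinct: two such walks
-- with a common end would close up to a cycle of length 4 or 6.
min-degree-cube-≤ : ∀ {n} (G : Graph n) → ¬ ContainsCycle G 4 → ¬ ContainsCycle G 6 →
  (S : Fin n → Set) → (∀ {v w} → S v → Edge G v w → S w) →
  ∀ {d r} → S r → (∀ {v} → S v → d < length (nbrs G v)) →
  suc d * ((d ∸ 1) * d) ≤ n
min-degree-cube-≤ {n} G noC4 noC6 S closed {d} {r} Sr large = begin
  suc d * ((d ∸ 1) * d)              ≤⟨ *-monoˡ-≤ ((d ∸ 1) * d) (large Sr) ⟩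
  length (nbrs G r) * ((d ∸ 1) * d)  ≤⟨ length-concatMap-≥ ends (nbrs G r) ends-≥ ⟩
  length (concatMap ends (nbrs G r)) ≤⟨ length-unique-≤ {ys = allFin n} all-unique (λ {x} _ → ∈-allFin x) ⟩
  length (allFin n)                  ≡⟨ length-tabulate id ⟩
  n                                  ∎
  where
  open ≤-Reasoning
  -- Keeping w away from r and its neighbours provides the inequalities by which the closed walks in
  -- `same-first` are genuine cycles.
  far? : Decidable (λ w → w ∉ r ∷ nbrs G r)
  far? w = ¬? (w ∈? (r ∷ nbrs G r))
  second : Fin n → List (Fin n)
  second q = filter far? (nbrs G q)
  third : Fin n → Fin n → List (Fin n)
  third q w = filter (λ z → ¬? (z ≟ q)) (nbrs G w)
  ends : Fin n → List (Fin n)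
  ends q = concatMap (third q) (second q)

  second⁻ : ∀ {q w} → w ∈ second q → Edge G q w × w ∉ r ∷ nbrs G r
  second⁻ {q} w∈ = let w∈N , far = ∈-filter⁻ far? {xs = nbrs G q} w∈ in ∈-nbrs⁻ G w∈N , far
  third⁻ : ∀ {q w z} → z ∈ third q w → Edge G w z × z ≢ q
  third⁻ {q} {w} z∈ = let z∈N , z≢q = ∈-filter⁻ (λ z → ¬? (z ≟ q)) {xs = nbrs G w} z∈ in ∈-nbrs⁻ G z∈N , z≢q

  -- The close neighbours of q are r itself and at most one common neighbour of q and r. Hence at
  -- least d - 1 of the d + 1 or more neighbours of q survive in `second q`.
  close-≤2 : ∀ {q} → Edge G r q → length (filter (_∈? (r ∷ nbrs G r)) (nbrs G q)) ≤ 2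
  close-≤2 {q} rq = ≤-trans
    (length-unique-≤ {ys = r ∷ filter (_∈? nbrs G r) (nbrs G q)}
      (Uniqueₚ.filter⁺ (_∈? (r ∷ nbrs G r)) (nbrs-unique G q)) sub)
    (s≤s (length-constant-≤1 (Uniqueₚ.filter⁺ (_∈? nbrs G r) (nbrs-unique G q)) const))
    where
    sub : ∀ {w} → w ∈ filter (_∈? (r ∷ nbrs G r)) (nbrs G q) →
      w ∈ r ∷ filter (_∈? nbrs G r) (nbrs G q)
    sub w∈ with ∈-filter⁻ (_∈? (r ∷ nbrs G r)) {xs = nbrs G q} w∈
    ... | _ , here eq = here eq
    ... | w∈q , there w∈r = there (∈-filter⁺ (_∈? nbrs G r) w∈q w∈r)
    const : ∀ {w w′} → w ∈ filter (_∈? nbrs G r) (nbrs G q) →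
      w′ ∈ filter (_∈? nbrs G r) (nbrs G q) → w ≡ w′
    const w∈ w′∈ =
      let w∈q , w∈r = ∈-filter⁻ (_∈? nbrs G r) {xs = nbrs G q} w∈
          w′∈q , w′∈r = ∈-filter⁻ (_∈? nbrs G r) {xs = nbrs G q} w′∈
      in common-nbr-unique G noC4 (edge⇒≢ G rq)
           (∈-nbrs⁻ G w∈r) (∈-nbrs⁻ G w′∈r) (∈-nbrs⁻ G w∈q) (∈-nbrs⁻ G w′∈q)

  second-≥ : ∀ {q} → q ∈ nbrs G r → d ∸ 1 ≤ length (second q)
  second-≥ {q} q∈ = ∸-monoˡ-≤ {suc d} 2 (≤-trans (large (closed Sr rq))
      (≤-trans (≤-reflexive (sym (length-filter-split (_∈? (r ∷ nbrs G r)) (nbrs G q))))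
        (+-monoˡ-≤ _ (close-≤2 rq))))
    where rq = ∈-nbrs⁻ G q∈

  third-≥ : ∀ {q w} → q ∈ nbrs G r → w ∈ second q → d ≤ length (third q w)
  third-≥ {q} {w} q∈ w∈ = ≤-pred (≤-trans (large Sw)
      (≤-trans (≤-reflexive (sym (length-filter-split (_≟ q) (nbrs G w))))
        (+-monoˡ-≤ _ (length-constant-≤1 (Uniqueₚ.filter⁺ (_≟ q) (nbrs-unique G w))
          λ x∈ y∈ → trans (proj₂ (∈-filter⁻ (_≟ q) {xs = nbrs G w} x∈))
            (sym (proj₂ (∈-filter⁻ (_≟ q) {xs = nbrs G w} y∈)))))))
    where Sw = closed (closed Sr (∈-nbrs⁻ G q∈)) (proj₁ (second⁻ w∈))

  ends-≥ : ∀ {q} → q ∈ nbrs G r → (d ∸ 1) * d ≤ length (ends q)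
  ends-≥ {q} q∈ = ≤-trans (*-monoˡ-≤ d (second-≥ q∈))
    (length-concatMap-≥ (third q) (second q) (third-≥ q∈))

  all-unique : Unique (concatMap ends (nbrs G r))
  all-unique = concatMap-unique ends (nbrs-unique G r)
    (λ {q} q∈ → concatMap-unique (third q) (Uniqueₚ.filter⁺ far? (nbrs-unique G q))
      (λ {w} _ → Uniqueₚ.filter⁺ (λ z → ¬? (z ≟ q)) (nbrs-unique G w))
      λ w∈ w′∈ z∈ z∈′ → let qw , _ = second⁻ w∈ ; qw′ , _ = second⁻ w′∈
                            wz , z≢q = third⁻ z∈ ; w′z , _ = third⁻ z∈′
        in common-nbr-unique G noC4 (≢-sym z≢q) qw qw′ (edge-sym G wz) (edge-sym G w′z))
    same-first
    where
    -- For q ≢ q′ the walks close up to the 4-cycle r, q, w, q′ if w ≡ w′, and to the 6-cycle r, q,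
    -- w, z, w′, q′ otherwise.
    same-first : ∀ {q q′ z} → q ∈ nbrs G r → q′ ∈ nbrs G r → z ∈ ends q → z ∈ ends q′ → q ≡ q′
    same-first {q} {q′} {z} q∈ q′∈ z∈ z∈′
      with find (∈-concatMap⁻ (third q) {xs = second q} z∈) | find (∈-concatMap⁻ (third q′) {xs = second q′} z∈′)
    ... | w , w∈ , z∈w | w′ , w′∈ , z∈w′
      with second⁻ w∈ | second⁻ w′∈ | third⁻ z∈w | third⁻ z∈w′
    ... | qw , w-far | q′w′ , w′-far | wz , z≢q | w′z , z≢q′ with q ≟ q′ | w ≟ w′
    ... | yes q≡q′ | _ = q≡q′
    ... | no q≢q′ | yes refl = common-nbr-unique G noC4 (w-far ∘ here ∘ sym)
        (∈-nbrs⁻ G q∈) (∈-nbrs⁻ G q′∈) (edge-sym G qw) (edge-sym G q′w′)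
    ... | no q≢q′ | no w≢w′ = ⊥-elim (no-hexagon G noC6
        (∈-nbrs⁻ G q∈) qw wz (edge-sym G w′z) (edge-sym G q′w′) (edge-sym G (∈-nbrs⁻ G q′∈))
        (w-far ∘ here ∘ sym) (w′-far ∘ here ∘ sym) w≢w′ (≢-sym z≢q) q≢q′ z≢q′
        (λ { refl → w-far (there (∈-nbrs⁺ G (edge-sym G wz))) })
        (λ { refl → w-far (there q′∈) })
        (λ { refl → w′-far (there q∈) }))

-- Moving a vertex out of conflict

-- The map u ↦ x ↦ y ↦ u, which degenerates to the transposition of u and y when x ≡ y.
module Rotation {n} (u x y : Fin n) (x≢u : x ≢ u) (y≢u : y ≢ u) where

  -- Describing the rotation by a relation reduces its properties to case splits on pairs of
  -- constructors. The condition `p ≢ y` in `at-x` gives `at-y` precedence when x ≡ y.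
  data Image (p r : Fin n) : Set where
    at-u : p ≡ u → r ≡ x → Image p r
    at-y : p ≡ y → r ≡ u → Image p r
    at-x : p ≡ x → p ≢ y → r ≡ y → Image p r
    else : p ≢ u → p ≢ y → p ≢ x → r ≡ p → Image p r

  image : ∀ p → ∃ (Image p)
  image p with p ≟ u | p ≟ y | p ≟ x
  ... | yes p≡u | _ | _ = x , at-u p≡u refl
  ... | no _ | yes p≡y | _ = u , at-y p≡y refl
  ... | no _ | no p≢y | yes p≡x = y , at-x p≡x p≢y refl
  ... | no p≢u | no p≢y | no p≢x = p , else p≢u p≢y p≢x refl

  rotate : Fin n → Fin n
  rotate p = proj₁ (image p)

  image-injective : ∀ {p q r} → Image p r → Image q r → p ≡ q
  image-injective (at-u refl _) (at-u refl _) = refl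
  image-injective (at-u refl refl) (at-y refl x≡u) = contradiction x≡u x≢u
  image-injective (at-u refl refl) (at-x refl x≢y x≡y) = contradiction x≡y x≢y
  image-injective (at-u refl refl) (else _ _ q≢x refl) = contradiction refl q≢x
  image-injective (at-y refl refl) (at-u refl u≡x) = contradiction (sym u≡x) x≢u
  image-injective (at-y refl _) (at-y refl _) = refl
  image-injective (at-y refl refl) (at-x refl _ u≡y) = contradiction (sym u≡y) y≢u
  image-injective (at-y refl refl) (else q≢u _ _ refl) = contradiction refl q≢u
  image-injective (at-x refl x≢y refl) (at-u refl y≡x) = contradiction (sym y≡x) x≢y
  image-injective (at-x refl _ refl) (at-y refl y≡u) = contradiction y≡u y≢u
  image-injective (at-x refl _ _) (at-x refl _ _) = refl
  image-injective (at-x refl _ refl) (else _ q≢y _ refl) = contradiction refl q≢y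
  image-injective (else _ _ p≢x refl) (at-u refl p≡x) = contradiction p≡x p≢x
  image-injective (else p≢u _ _ refl) (at-y refl p≡u) = contradiction p≡u p≢u
  image-injective (else _ p≢y _ refl) (at-x refl _ p≡y) = contradiction p≡y p≢y
  image-injective (else _ _ _ refl) (else _ _ _ refl) = refl

  rotate-injective : Injective _≡_ _≡_ rotate
  rotate-injective {p} {q} eq =
    image-injective (proj₂ (image p)) (subst (Image q) (sym eq) (proj₂ (image q)))

  -- Only edges of G meeting u, x or y change their image. Edges from these vertices to fixed ones
  -- are covered by the three conditions that quantify over z, and the pairs inside {u, x, y} by
  -- `¬ux`, `¬uy` and `¬ruy`, the last because the pair x, y is sent to y, u.
  rotate-packs : (G R : Graph n) →
    (∀ {p q} → p ≢ u → q ≢ u → Edge G p q → ¬ Edge R p q) →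
    ¬ Edge G u x → (∀ {z} → Edge G u z → ¬ Edge R z x) →
    ¬ Edge G u y → ¬ Edge R u y → (∀ {z} → Edge R u z → ¬ Edge G z y) →
    (∀ {z} → Edge G x z → ¬ Edge R z y) →
    ∀ p q → Edge G p q → ¬ Edge R (rotate p) (rotate q)
  rotate-packs G R off ¬ux ¬uzx ¬uy ¬ruy ¬uzy ¬xzy p q e r =
    conflict (proj₂ (image p)) (proj₂ (image q)) e r
    where
    loop : ∀ {v} → ¬ Edge G v v
    loop e = edge⇒≢ G e refl
    conflict : ∀ {p q p′ q′} → Image p p′ → Image q q′ → Edge G p q → ¬ Edge R p′ q′
    conflict (at-u refl _) (at-u refl _) e _ = loop e
    conflict (at-u refl _) (at-y refl _) e _ = ¬uy e
    conflict (at-u refl _) (at-x refl _ _) e _ = ¬ux e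
    conflict (at-u refl refl) (else _ _ _ refl) e r = ¬uzx e (edge-sym R r)
    conflict (at-y refl _) (at-u refl _) e _ = ¬uy (edge-sym G e)
    conflict (at-y refl _) (at-y refl _) e _ = loop e
    conflict (at-y refl refl) (at-x refl _ refl) _ r = ¬ruy r
    conflict (at-y refl refl) (else _ _ _ refl) e r = ¬uzy r (edge-sym G e)
    conflict (at-x refl _ _) (at-u refl _) e _ = ¬ux (edge-sym G e)
    conflict (at-x refl _ refl) (at-y refl refl) _ r = ¬ruy (edge-sym R r)
    conflict (at-x refl _ _) (at-x refl _ _) e _ = loop e
    conflict (at-x refl _ refl) (else _ _ _ refl) e r = ¬xzy e (edge-sym R r)
    conflict (else _ _ _ refl) (at-u refl refl) e r = ¬uzx (edge-sym G e) r
    conflict (else _ _ _ refl) (at-y refl refl) e r = ¬uzy (edge-sym R r) e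
    conflict (else _ _ _ refl) (at-x refl _ refl) e r = ¬xzy (edge-sym G e) r
    conflict (else p≢u _ _ refl) (else q≢u _ _ refl) e r = off p≢u q≢u e r

module Reinsertion {n} (G R : Graph n)
  (G4 : ¬ ContainsCycle G 4) (G6 : ¬ ContainsCycle G 6) (G8 : ¬ ContainsCycle G 8)
  (R4 : ¬ ContainsCycle R 4) {a b : ℕ}
  (ΔG : ∀ v → length (nbrs G v) ≤ a) (ΔR : ∀ v → length (nbrs R v) ≤ b) where

  -- Counting the positions x that fail for both y and y′

  module _ (y y′ : Fin n) (y≢y′ : y ≢ y′) where

    -- These are the x for which y′ violates the last condition of `rotate-packs`.
    Hit : Fin n → Set
    Hit x = Any (Edge G x) (nbrs R y′)

    hit? : Decidable Hit
    hit? x = any? (edge? G x) (nbrs R y′)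

    π : Fin n → Fin n
    π x with hit? x
    ... | yes h = proj₁ (find h)
    -- A default value: `π` is evaluated on classes, all of whose members are hit.
    ... | no _ = x

    π-hit : ∀ {x} → Hit x → π x ∈ nbrs R y′ × Edge G x (π x)
    π-hit {x} h with hit? x
    ... | yes h′ = proj₂ (find h′)
    ... | no ¬h = contradiction h ¬h

    -- Leaving out the two neighbourhoods costs at most 2b further blocked vertices and keeps class
    -- members distinct from the centres and from the values of `π`, as the cycle arguments require.
    Outer : Fin n → Set
    Outer x = x ∉ nbrs R y × x ∉ nbrs R y′ × Hit x

    outer? : Decidable Outer
    outer? x = ¬? (x ∈? nbrs R y) ×-dec ¬? (x ∈? nbrs R y′) ×-dec hit? x

    class : Fin n → List (Fin n)
    class p = filter outer? (nbrs G p)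

    class-unique : ∀ p → Unique (class p)
    class-unique p = Uniqueₚ.filter⁺ outer? (nbrs-unique G p)

    -- A shared neighbour p could equal `π x`, which would spoil the cycle arguments. There is at
    -- most one, or else R has a 4-cycle through y and y′, so its whole neighbourhood in G can be
    -- blocked at cost a.
    centres shared : List (Fin n)
    centres = filter (λ p → ¬? (p ∈? nbrs R y′)) (nbrs R y)
    shared = filter (_∈? nbrs R y′) (nbrs R y)

    centres⁻ : ∀ {p} → p ∈ centres → p ∈ nbrs R y × p ∉ nbrs R y′
    centres⁻ = ∈-filter⁻ (λ p → ¬? (p ∈? nbrs R y′)) {xs = nbrs R y}

    length-shared : length shared ≤ 1
    length-shared = length-constant-≤1 (Uniqueₚ.filter⁺ (_∈? nbrs R y′) (nbrs-unique R y))
      λ p∈ q∈ → let p∈y , p∈y′ = ∈-filter⁻ (_∈? nbrs R y′) {xs = nbrs R y} p∈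
                    q∈y , q∈y′ = ∈-filter⁻ (_∈? nbrs R y′) {xs = nbrs R y} q∈
        in common-nbr-unique R R4 y≢y′ (∈-nbrs⁻ R p∈y) (∈-nbrs⁻ R q∈y) (∈-nbrs⁻ R p∈y′) (∈-nbrs⁻ R q∈y′)

    class⁻ : ∀ {p x} → x ∈ class p →
      Edge G p x × x ∉ nbrs R y × x ∉ nbrs R y′ × π x ∈ nbrs R y′ × Edge G x (π x)
    class⁻ {p} x∈ =
      let x∈p , x∉y , x∉y′ , h = ∈-filter⁻ outer? {xs = nbrs G p} x∈
      in ∈-nbrs⁻ G x∈p , x∉y , x∉y′ , π-hit h

    ∉-separate : ∀ {xs : List (Fin n)} {p q} → p ∉ xs → q ∈ xs → p ≢ q
    ∉-separate p∉ q∈ refl = p∉ q∈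

    -- The vertices p and `π x` are distinct, since only the latter is in `nbrs R y′`, and x, x′ are
    -- common neighbours of both.
    π-injective : ∀ {p} → p ∈ centres → ∀ {x x′} → x ∈ class p → x′ ∈ class p → π x ≡ π x′ → x ≡ x′
    π-injective p∈ {x} {x′} x∈ x′∈ eq =
      let px , _ , _ , πx∈ , x-πx = class⁻ x∈
          px′ , _ , _ , _ , x′-πx′ = class⁻ x′∈
      in common-nbr-unique G G4 (∉-separate (proj₂ (centres⁻ p∈)) πx∈) px px′
           (edge-sym G x-πx) (subst (λ z → Edge G z x′) (sym eq) (edge-sym G x′-πx′))

    length-class : ∀ {p} → p ∈ centres → length (class p) ≤ b
    length-class {p} p∈ = ≤-trans
      (length-injective-≤ π (class-unique p) (λ x∈ → proj₁ (proj₂ (proj₂ (proj₂ (class⁻ x∈))))) (π-injective p∈))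
      (ΔR y′)

    -- Two classes that agree under π in two places produce a cycle of length 4, 6 or 8.
    overlap-unique : ∀ {p q} → p ∈ centres → q ∈ centres → p ≢ q →
      ∀ {x x′ z z′} → x ∈ class q → x′ ∈ class q → z ∈ class p → z′ ∈ class p →
      π x ≡ π z → π x′ ≡ π z′ → x ≡ x′
    overlap-unique {p} {q} p∈ q∈ p≢q {x} {x′} {z} {z′} x∈ x′∈ z∈ z′∈ πx≡πz πx′≡πz′
      with x ≟ x′
    ... | yes x≡x′ = x≡x′
    ... | no x≢x′ with centres⁻ p∈ | centres⁻ q∈ | class⁻ x∈ | class⁻ x′∈ | class⁻ z∈ | class⁻ z′∈
    ... | p∈y , p∉y′ | q∈y , q∉y′
        | qx , x∉y , x∉y′ , πx∈ , x-πx | qx′ , x′∉y , x′∉y′ , πx′∈ , x′-πx′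
        | pz , z∉y , z∉y′ , _ , z-πz | pz′ , z′∉y , z′∉y′ , _ , z′-πz′ = cases (z ≟ x) (z′ ≟ x′)
      where
      πx≢πx′ : π x ≢ π x′
      πx≢πx′ eq = x≢x′ (π-injective q∈ x∈ x′∈ eq)
      z-πx : Edge G z (π x)
      z-πx = subst (Edge G z) (sym πx≡πz) z-πz
      z′-πx′ : Edge G z′ (π x′)
      z′-πx′ = subst (Edge G z′) (sym πx′≡πz′) z′-πz′
      x≢z′ : x ≢ z′
      x≢z′ refl = πx≢πx′ (sym πx′≡πz′)
      z≢x′ : z ≢ x′
      z≢x′ refl = πx≢πx′ πx≡πz
      z≢z′ : z ≢ z′
      z≢z′ refl = πx≢πx′ (trans πx≡πz (sym πx′≡πz′))
      p≢πx = ∉-separate p∉y′ πx∈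
      p≢πx′ = ∉-separate p∉y′ πx′∈
      q≢πx = ∉-separate q∉y′ πx∈
      q≢πx′ = ∉-separate q∉y′ πx′∈
      Centre : Fin n → Set
      Centre v = v ∈ nbrs R y ⊎ v ∈ nbrs R y′
      not-centre : ∀ {v} → v ∉ nbrs R y → v ∉ nbrs R y′ → ¬ Centre v
      not-centre v∉y _ (inj₁ v∈) = v∉y v∈
      not-centre _ v∉y′ (inj₂ v∈) = v∉y′ v∈
      -- With both equalities p, x, q, x′ is a 4-cycle. With one of them, a 6-cycle passes through
      -- p, q and one value of `π`. With neither, an 8-cycle alternates between the centres p,
      -- `π x`, q, `π x′` and the outer vertices z, x, x′, z′.
      cases : Dec (z ≡ x) → Dec (z′ ≡ x′) → x ≡ x′
      cases (yes refl) (yes refl) = common-nbr-unique G G4 p≢q pz pz′ qx qx′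
      cases (yes refl) (no z′≢x′) = ⊥-elim (no-hexagon G G6
        pz (edge-sym G qx) qx′ x′-πx′ (edge-sym G z′-πx′) (edge-sym G pz′)
        p≢q p≢πx′ q≢πx′ x≢x′ x≢z′ (≢-sym z′≢x′)
        (≢-sym (∉-separate x′∉y p∈y)) (≢-sym (∉-separate z′∉y q∈y)) (≢-sym (∉-separate x∉y′ πx′∈)))
      cases (no z≢x) (yes refl) = ⊥-elim (no-hexagon G G6
        pz′ (edge-sym G qx′) qx x-πx (edge-sym G z-πx) (edge-sym G pz)
        p≢q p≢πx q≢πx (≢-sym x≢x′) (≢-sym z≢x′) (≢-sym z≢x)
        (≢-sym (∉-separate x∉y p∈y)) (≢-sym (∉-separate z∉y q∈y)) (≢-sym (∉-separate x′∉y′ πx∈)))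
      cases (no z≢x) (no z′≢x′) = ⊥-elim (no-octagon G G8 Centre
        pz z-πx (edge-sym G x-πx) (edge-sym G qx) qx′ x′-πx′ (edge-sym G z′-πx′) (edge-sym G pz′)
        (inj₁ p∈y) (inj₂ πx∈) (inj₁ q∈y) (inj₂ πx′∈)
        (not-centre z∉y z∉y′) (not-centre x∉y x∉y′) (not-centre x′∉y x′∉y′) (not-centre z′∉y z′∉y′)
        p≢πx p≢q p≢πx′ (≢-sym q≢πx) πx≢πx′ q≢πx′
        z≢x z≢x′ z≢z′ x≢x′ x≢z′ (≢-sym z′≢x′))

    -- By `overlap-unique` at most one member of `class q` repeats a value of `π` on `class p`. The
    -- other members together with `class p` inject into `nbrs R y′`.
    length-two-classes : ∀ {p q} → p ∈ centres → q ∈ centres → p ≢ q →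
      length (class p) + length (class q) ≤ suc b
    length-two-classes {p} {q} p∈ q∈ p≢q = begin
      length (class p) + length (class q)
        ≡⟨ cong (length (class p) +_) (sym (length-filter-split old? (class q))) ⟩
      length (class p) + (length (filter old? (class q)) + length new)
        ≤⟨ +-monoʳ-≤ _ (+-monoˡ-≤ _ (length-constant-≤1 (Uniqueₚ.filter⁺ old? (class-unique q)) old-const)) ⟩
      length (class p) + suc (length new)
        ≡⟨ trans (+-suc _ _) (cong suc (sym (length-++ (class p)))) ⟩
      suc (length (class p ++ new))
        ≤⟨ s≤s (≤-trans (length-injective-≤ π union-unique hits inj) (ΔR y′)) ⟩
      suc b ∎
      where
      open ≤-Reasoning
      Old : Fin n → Set
      Old x = Any (λ z → π x ≡ π z) (class p)
      old? : Decidable Old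
      old? x = any? (λ z → π x ≟ π z) (class p)
      new : List (Fin n)
      new = filter (¬? ∘ old?) (class q)
      new⁻ : ∀ {x} → x ∈ new → x ∈ class q × ¬ Old x
      new⁻ = ∈-filter⁻ (¬? ∘ old?) {xs = class q}
      old-const : ∀ {x x′} → x ∈ filter old? (class q) → x′ ∈ filter old? (class q) → x ≡ x′
      old-const x∈ x′∈ =
        let x∈q , ox = ∈-filter⁻ old? {xs = class q} x∈
            x′∈q , ox′ = ∈-filter⁻ old? {xs = class q} x′∈
            _ , z∈ , eq = find ox
            _ , z′∈ , eq′ = find ox′
        in overlap-unique p∈ q∈ p≢q x∈q x′∈q z∈ z′∈ eq eq′
      union-unique : Unique (class p ++ new)
      union-unique = Uniqueₚ.++⁺ (class-unique p) (Uniqueₚ.filter⁺ (¬? ∘ old?) (class-unique q))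
        λ (x∈p , x∈new) → proj₂ (new⁻ x∈new) (lose x∈p refl)
      hits : ∀ {x} → x ∈ class p ++ new → π x ∈ nbrs R y′
      hits x∈ with ∈-++⁻ (class p) x∈
      ... | inj₁ x∈p = proj₁ (proj₂ (proj₂ (proj₂ (class⁻ x∈p))))
      ... | inj₂ x∈n = proj₁ (proj₂ (proj₂ (proj₂ (class⁻ (proj₁ (new⁻ x∈n))))))
      inj : ∀ {x x′} → x ∈ class p ++ new → x′ ∈ class p ++ new → π x ≡ π x′ → x ≡ x′
      inj x∈ x′∈ eq with ∈-++⁻ (class p) x∈ | ∈-++⁻ (class p) x′∈
      ... | inj₁ x∈p | inj₁ x′∈p = π-injective p∈ x∈p x′∈p eq
      ... | inj₁ x∈p | inj₂ x′∈n = contradiction (lose x∈p (sym eq)) (proj₂ (new⁻ x′∈n))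
      ... | inj₂ x∈n | inj₁ x′∈p = contradiction (lose x′∈p eq) (proj₂ (new⁻ x∈n))
      ... | inj₂ x∈n | inj₂ x′∈n = π-injective q∈ (proj₁ (new⁻ x∈n)) (proj₁ (new⁻ x′∈n)) eq

    blocked : List (Fin n)
    blocked = nbrs R y ++ nbrs R y′ ++ concatMap (nbrs G) shared ++ concatMap class centres

    -- The doubling keeps the halved quadratic term from `length-concatMap-pairs-≤` integral.
    length-blocked : 2 * length blocked ≤ 2 * (b + b + a) + (b * suc b + b)
    length-blocked = begin
      2 * length blocked
        ≡⟨ cong (2 *_) (trans (length-++ (nbrs R y)) (cong (length (nbrs R y) +_)
             (trans (length-++ (nbrs R y′)) (cong (length (nbrs R y′) +_)
             (length-++ (concatMap (nbrs G) shared)))))) ⟩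
      2 * (length (nbrs R y) + (length (nbrs R y′) + (length (concatMap (nbrs G) shared) + c)))
        ≤⟨ *-monoʳ-≤ 2 (+-mono-≤ (ΔR y) (+-mono-≤ (ΔR y′) (+-monoˡ-≤ c through-shared))) ⟩
      2 * (b + (b + (a + c)))
        ≡⟨ regroup a b c ⟩
      2 * (b + b + a) + 2 * c
        ≤⟨ +-monoʳ-≤ (2 * (b + b + a)) (≤-trans
             (length-concatMap-pairs-≤ class b (Uniqueₚ.filter⁺ (λ p → ¬? (p ∈? nbrs R y′)) (nbrs-unique R y))
               length-class length-two-classes)
             (+-monoˡ-≤ b (*-monoˡ-≤ (suc b)
               (≤-trans (length-filter (λ p → ¬? (p ∈? nbrs R y′)) (nbrs R y)) (ΔR y))))) ⟩
      2 * (b + b + a) + (b * suc b + b) ∎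
      where
      open ≤-Reasoning
      c = length (concatMap class centres)
      regroup : ∀ a b c → 2 * (b + (b + (a + c))) ≡ 2 * (b + b + a) + 2 * c
      regroup = solve-∀
      through-shared : length (concatMap (nbrs G) shared) ≤ a
      through-shared = ≤-trans (length-concatMap-≤ (nbrs G) shared (λ {x} _ → ΔG x))
        (≤-trans (*-monoˡ-≤ a length-shared) (≤-reflexive (*-identityˡ a)))

    -- If x is not hit, y′ works. If x is hit, y works: a common vertex z of `nbrs G x` and
    -- `nbrs R y` is either shared or a centre, and in both cases x would be blocked.
    ∉-blocked : ∀ {x} → x ∉ blocked →
      (∀ {z} → Edge G x z → ¬ Edge R z y) ⊎ (∀ {z} → Edge G x z → ¬ Edge R z y′)
    ∉-blocked {x} x∉ with hit? x
    ... | no ¬h = inj₂ λ xz zy′ → ¬h (lose (∈-nbrs⁺ R (edge-sym R zy′)) xz)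
    ... | yes h = inj₁ λ {z} xz zy → through z (∈-nbrs⁺ R (edge-sym R zy)) (∈-nbrs⁺ G (edge-sym G xz))
      where
      x∉₂ = x∉ ∘ ∈-++⁺ʳ (nbrs R y)
      x∉₃ = x∉₂ ∘ ∈-++⁺ʳ (nbrs R y′)
      through : ∀ z → z ∈ nbrs R y → x ∈ nbrs G z → ⊥
      through z z∈y x∈z with z ∈? nbrs R y′
      ... | yes z∈y′ = x∉₃ (∈-++⁺ˡ (∈-concatMap (nbrs G) (∈-filter⁺ (_∈? nbrs R y′) z∈y z∈y′) x∈z))
      ... | no z∉y′ = x∉₃ (∈-++⁺ʳ (concatMap (nbrs G) shared) (∈-concatMap class
            (∈-filter⁺ (λ p → ¬? (p ∈? nbrs R y′)) z∈y z∉y′)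
            (∈-filter⁺ outer? x∈z (x∉ ∘ ∈-++⁺ˡ , x∉₂ ∘ ∈-++⁺ˡ , h))))

  -- Choosing y, y′ and x, and reinserting u

  module _ {δ} (u : Fin n) (du : length (nbrs G u) ≤ δ) where

    -- These lists collect the conditions of `rotate-packs` on y alone and on x alone; the joint
    -- condition on x and y is left to `blocked`.
    bad-y bad-x : List (Fin n)
    bad-y = u ∷ nbrs G u ++ nbrs R u ++ concatMap (nbrs G) (nbrs R u)
    bad-x = u ∷ nbrs G u ++ concatMap (nbrs R) (nbrs G u)

    length-bad-y : length bad-y ≤ 1 + (δ + (b + b * a))
    length-bad-y = s≤s (begin
      length (nbrs G u ++ nbrs R u ++ concatMap (nbrs G) (nbrs R u))
        ≡⟨ trans (length-++ (nbrs G u)) (cong (length (nbrs G u) +_) (length-++ (nbrs R u))) ⟩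
      length (nbrs G u) + (length (nbrs R u) + length (concatMap (nbrs G) (nbrs R u)))
        ≤⟨ +-mono-≤ du (+-mono-≤ (ΔR u) (≤-trans
             (length-concatMap-≤ (nbrs G) (nbrs R u) (λ {x} _ → ΔG x)) (*-monoˡ-≤ a (ΔR u)))) ⟩
      δ + (b + b * a) ∎)
      where open ≤-Reasoning

    length-bad-x : length bad-x ≤ 1 + (δ + δ * b)
    length-bad-x = s≤s (begin
      length (nbrs G u ++ concatMap (nbrs R) (nbrs G u))
        ≡⟨ length-++ (nbrs G u) ⟩
      length (nbrs G u) + length (concatMap (nbrs R) (nbrs G u))
        ≤⟨ +-mono-≤ du (≤-trans
             (length-concatMap-≤ (nbrs R) (nbrs G u) (λ {x} _ → ΔR x)) (*-monoˡ-≤ b du)) ⟩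
      δ + δ * b ∎)
      where open ≤-Reasoning

    -- The 3 accounts for u in `bad-y`, for the first choice y, which y′ must also avoid, and for
    -- the strict inequality in `avoid`.
    choose-y : 3 + (δ + (b + b * a)) ≤ n → ∃ λ y → ∃ λ y′ → y ≢ y′ × y ∉ bad-y × y′ ∉ bad-y
    choose-y room
      with avoid bad-y (≤-trans (s≤s length-bad-y) (≤-trans (n≤1+n _) room))
    ... | y , y∉ with avoid (y ∷ bad-y) (≤-trans (s≤s (s≤s length-bad-y)) room)
    ... | y′ , y′∉ = y , y′ , y′∉ ∘ here ∘ sym , y∉ , y′∉ ∘ there

    choose-x : 2 * (2 + (δ + δ * b)) + (2 * (b + b + a) + (b * suc b + b)) ≤ 2 * n →
      ∀ y y′ (y≢y′ : y ≢ y′) → ∃ λ x → x ∉ bad-x × x ∉ blocked y y′ y≢y′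
    choose-x room y y′ y≢y′ = split (avoid (bad-x ++ bl) (*-cancelˡ-< 2 _ _ short))
      where
      open ≤-Reasoning
      bl : List (Fin n)
      bl = blocked y y′ y≢y′
      split : (∃ λ x → x ∉ bad-x ++ bl) → ∃ λ x → x ∉ bad-x × x ∉ bl
      split (x , x∉) = x , x∉ ∘ ∈-++⁺ˡ , x∉ ∘ ∈-++⁺ʳ bad-x
      short : 2 * length (bad-x ++ bl) < 2 * n
      short = begin
        suc (2 * length (bad-x ++ bl))
          ≡⟨ cong (λ l → suc (2 * l)) (length-++ bad-x) ⟩
        suc (2 * (length bad-x + length bl))
          ≡⟨ cong suc (*-distribˡ-+ 2 (length bad-x) (length bl)) ⟩
        suc (2 * length bad-x + 2 * length bl)
          ≤⟨ s≤s (+-mono-≤ (*-monoʳ-≤ 2 length-bad-x) (length-blocked y y′ y≢y′)) ⟩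
        suc (2 * (1 + (δ + δ * b)) + (2 * (b + b + a) + (b * suc b + b)))
          ≤⟨ +-monoˡ-≤ (2 * (b + b + a) + (b * suc b + b)) (*-monoʳ-< 2 (n<1+n (1 + (δ + δ * b)))) ⟩
        2 * (2 + (δ + δ * b)) + (2 * (b + b + a) + (b * suc b + b))
          ≤⟨ room ⟩
        2 * n ∎

    Move : Set
    Move = ∃ λ σ → Injective _≡_ _≡_ σ × (∀ p q → Edge G p q → ¬ Edge R (σ p) (σ q))

    move : (∀ {p q} → p ≢ u → q ≢ u → Edge G p q → ¬ Edge R p q) →
      ∀ x y → x ∉ bad-x → y ∉ bad-y → (∀ {z} → Edge G x z → ¬ Edge R z y) → Move
    move off x y x∉ y∉ free = rotate , rotate-injective , rotate-packs G R off
      (λ e → x∉ (there (∈-++⁺ˡ (∈-nbrs⁺ G e))))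
      (λ e r → x∉ (there (∈-++⁺ʳ (nbrs G u) (∈-concatMap (nbrs R) (∈-nbrs⁺ G e) (∈-nbrs⁺ R r)))))
      (λ e → y∉ (there (∈-++⁺ˡ (∈-nbrs⁺ G e))))
      (λ r → y∉ (there (∈-++⁺ʳ (nbrs G u) (∈-++⁺ˡ (∈-nbrs⁺ R r)))))
      (λ r e → y∉ (there (∈-++⁺ʳ (nbrs G u) (∈-++⁺ʳ (nbrs R u)
        (∈-concatMap (nbrs G) (∈-nbrs⁺ R r) (∈-nbrs⁺ G e))))))
      free
      where open Rotation u x y (x∉ ∘ here) (y∉ ∘ here)

    reinsert : 3 + (δ + (b + b * a)) ≤ n →
      2 * (2 + (δ + δ * b)) + (2 * (b + b + a) + (b * suc b + b)) ≤ 2 * n →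
      (∀ {p q} → p ≢ u → q ≢ u → Edge G p q → ¬ Edge R p q) → Move
    reinsert room₁ room₂ off =
      let y , y′ , y≢y′ , y∉ , y′∉ = choose-y room₁
          x , x∉ , x-free = choose-x room₂ y y′ y≢y′
      in Sum.[ move off x y x∉ y∉ , move off x y′ x∉ y′∉ ] (∉-blocked y y′ y≢y′ x-free)

-- Inserting all vertices

-- Transporting `G₂` along the current placement g puts both graphs on one vertex set, so that a
-- rotation σ improves g to `g ∘ σ`.
pullback : ∀ {n} → (Fin n → Fin n) → Graph n → Graph n
pullback g G .adj u v = adj G (g u) (g v)
pullback g G .symmetric u v = symmetric G (g u) (g v)
pullback g G .loopless v = loopless G (g v)

inside : ∀ {n} → List (Fin n) → Fin n → Bool
inside S v = does (v ∈? S)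

-- All n vertices are kept and those outside `S` become isolated, so that any vertex remains
-- available as x or y in a rotation.
induced : ∀ {n} → Graph n → List (Fin n) → Graph n
induced G S .adj u v = adj G u v ∧ (inside S u ∧ inside S v)
induced G S .symmetric u v = cong₂ _∧_ (symmetric G u v) (∧-comm (inside S u) (inside S v))
induced G S .loopless v = cong (_∧ (inside S v ∧ inside S v)) (loopless G v)

induced⁺ : ∀ {n} (G : Graph n) S {u v} → u ∈ S → v ∈ S → Edge G u v → Edge (induced G S) u v
induced⁺ G S {u} {v} u∈ v∈ e =
  cong₂ _∧_ e (cong₂ _∧_ (dec-true (u ∈? S) u∈) (dec-true (v ∈? S) v∈))

induced⁻ : ∀ {n} (G : Graph n) S {u v} → Edge (induced G S) u v → Edge G u v × u ∈ S × v ∈ S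
induced⁻ G S {u} {v} e with adj G u v | u ∈? S | v ∈? S
... | true | yes u∈ | yes v∈ = refl , u∈ , v∈

cycle-map : ∀ {n k} (H G : Graph n) (f : Fin n → Fin n) → Injective _≡_ _≡_ f →
  (∀ {u v} → Edge H u v → Edge G (f u) (f v)) → ContainsCycle H k → ContainsCycle G k
cycle-map H G f f-inj f-edge (c , c-inj , walk) =
  f ∘ c , (λ eq → c-inj (f-inj eq)) , λ i j next → f-edge (walk i j next)

length-nbrs-map-≤ : ∀ {n} (H G : Graph n) (f : Fin n → Fin n) → Injective _≡_ _≡_ f →
  (∀ {u v} → Edge H u v → Edge G (f u) (f v)) → ∀ v → length (nbrs H v) ≤ length (nbrs G (f v))
length-nbrs-map-≤ H G f f-inj f-edge v = length-injective-≤ f (nbrs-unique H v)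
  (λ w∈ → ∈-nbrs⁺ G (f-edge (∈-nbrs⁻ H w∈))) (λ _ _ → f-inj)

-- The first inequality is the room for choosing y and y′, the second, doubled as in
-- `length-blocked`, the room for choosing x.
Room : ℕ → ℕ → ℕ → ℕ → Set
Room n a b δ = 3 + (δ + (b + b * a)) ≤ n ×
  2 * (2 + (δ + δ * b)) + (2 * (b + b + a) + (b * suc b + b)) ≤ 2 * n

module Insertion {n} (G₁ G₂ : Graph n)
  (G4 : ¬ ContainsCycle G₁ 4) (G6 : ¬ ContainsCycle G₁ 6) (G8 : ¬ ContainsCycle G₁ 8)
  (R4 : ¬ ContainsCycle G₂ 4) {a b : ℕ}
  (Δ₁ : ∀ v → length (nbrs G₁ v) ≤ a) (Δ₂ : ∀ v → length (nbrs G₂ v) ≤ b) where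

  subgraph-cycle : ∀ S {k} → ContainsCycle (induced G₁ S) k → ContainsCycle G₁ k
  subgraph-cycle S = cycle-map (induced G₁ S) G₁ id id (proj₁ ∘ induced⁻ G₁ S)

  -- Otherwise all degrees on `S` exceed d, and as edges of the induced graph stay in `S`,
  -- `min-degree-cube-≤` contradicts the size of n.
  low-degree-vertex : ∀ {d} → n < suc d * ((d ∸ 1) * d) → ∀ S {r} → r ∈ S →
    ∃ λ u → u ∈ S × length (nbrs (induced G₁ S) u) ≤ d
  low-degree-vertex {d} small S r∈ with any? (λ u → length (nbrs (induced G₁ S) u) ≤? d) S
  ... | yes found = find found
  ... | no none = contradiction
    (min-degree-cube-≤ (induced G₁ S) (G4 ∘ subgraph-cycle S) (G6 ∘ subgraph-cycle S)
      (_∈ S) (λ _ e → proj₂ (proj₂ (induced⁻ G₁ S e))) r∈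
      (λ v∈ → ≰⇒> λ low → none (lose v∈ low)))
    (<⇒≱ small)

  -- The bound δ is existential because the two regimes supply different values, a and a / 4.
  LowDegree : Set
  LowDegree = ∀ S {r} → r ∈ S →
    ∃ λ u → u ∈ S × ∃ λ δ → length (nbrs (induced G₁ S) u) ≤ δ × Room n a b δ

  -- A vertex u with room is removed, the rest is packed, and u is put back by a rotation. The
  -- recursion runs on the bound k, as a filtered list is not structurally smaller.
  pack-induced : LowDegree → ∀ k S → length S ≤ k →
    ∃ λ g → Injective _≡_ _≡_ g × (∀ p q → Edge (induced G₁ S) p q → ¬ Edge G₂ (g p) (g q))
  pack-induced low _ [] _ = id , id , λ p q e _ → case (proj₁ (proj₂ (induced⁻ G₁ [] {p} {q} e)))
    where
    case : ∀ {p} → p ∈ [] → ⊥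
    case ()
  pack-induced low (suc k) S@(_ ∷ _) (s≤s len) with low S (here refl)
  ... | u , u∈ , δ , du , room₁ , room₂ = g ∘ σ , (λ eq → σ-inj (g-inj eq)) , σ-packs
    where
    others : List (Fin n)
    others = filter (λ v → ¬? (v ≟ u)) S
    before = pack-induced low k others
      (≤-pred (≤-trans (filter-notAll (λ v → ¬? (v ≟ u)) S (lose u∈ (λ ne → ne refl))) (s≤s len)))
    g = proj₁ before
    g-inj : Injective _≡_ _≡_ g
    g-inj = proj₁ (proj₂ before)
    H R : Graph n
    H = induced G₁ S
    R = pullback g G₂
    off : ∀ {p q} → p ≢ u → q ≢ u → Edge H p q → ¬ Edge R p q
    off {p} {q} p≢u q≢u e = let e₁ , p∈ , q∈ = induced⁻ G₁ S e in
      proj₂ (proj₂ before) p q (induced⁺ G₁ others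
        (∈-filter⁺ (λ v → ¬? (v ≟ u)) p∈ p≢u) (∈-filter⁺ (λ v → ¬? (v ≟ u)) q∈ q≢u) e₁)
    open Reinsertion H R (G4 ∘ subgraph-cycle S) (G6 ∘ subgraph-cycle S) (G8 ∘ subgraph-cycle S)
      (R4 ∘ cycle-map R G₂ g g-inj id)
      (λ v → ≤-trans (length-nbrs-map-≤ H G₁ id id (proj₁ ∘ induced⁻ G₁ S) v) (Δ₁ v))
      (λ v → ≤-trans (length-nbrs-map-≤ R G₂ g g-inj id v) (Δ₂ (g v)))
    moved = reinsert u du room₁ room₂ off
    σ = proj₁ moved
    σ-inj : Injective _≡_ _≡_ σ
    σ-inj = proj₁ (proj₂ moved)
    σ-packs = proj₂ (proj₂ moved)

  pack : LowDegree → Pack G₁ G₂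
  pack low with pack-induced low _ (allFin n) ≤-refl
  ... | g , g-inj , packs = g , id , g-inj , id ,
    λ { u v _ _ e₁ e₂ (refl , refl) →
        packs u v (induced⁺ G₁ (allFin n) (∈-allFin u) (∈-allFin v) e₁) e₂ }

-- Arithmetic

-- To leading order 2db + b² is at most ab / 2 + ab, against 2ab available; the remaining ab / 2
-- absorbs the linear terms.
room-low-degree : ∀ {n a b d} → 1 ≤ b → b ≤ a → 24 ≤ a → 1 ≤ d → d * 4 ≤ a →
  suc a * suc b ≤ suc n → Room n a b d
room-low-degree {n} {a} {b} {d} 1≤b b≤a 24≤a 1≤d 4d≤a size = room₁ , room₂ b 1≤b b≤a n-large
  where
  open ≤-Reasoning
  n-large : a + b + b * a ≤ n
  n-large = ≤-pred (≤-trans (≤-reflexive (expand a b)) size)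
    where
    expand : ∀ a b → suc (a + b + b * a) ≡ suc a * suc b
    expand = solve-∀
  room₁ : 3 + (d + (b + b * a)) ≤ n
  room₁ = begin
    3 + (d + (b + b * a))         ≡⟨ regroup d (b + b * a) ⟩
    d + 3 * 1 + (b + b * a)       ≤⟨ +-monoˡ-≤ (b + b * a) (+-monoʳ-≤ d (*-monoʳ-≤ 3 1≤d)) ⟩
    d + 3 * d + (b + b * a)       ≡⟨ cong (_+ (b + b * a)) (*-comm 4 d) ⟩
    d * 4 + (b + b * a)           ≤⟨ +-monoˡ-≤ (b + b * a) 4d≤a ⟩
    a + (b + b * a)               ≡⟨ sym (+-assoc a b (b * a)) ⟩
    a + b + b * a                 ≤⟨ n-large ⟩
    n                             ∎
    where
    regroup : ∀ d e → 3 + (d + e) ≡ d + 3 * 1 + e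
    regroup = solve-∀
  room₂ : ∀ b → 1 ≤ b → b ≤ a → a + b + b * a ≤ n →
    2 * (2 + (d + d * b)) + (2 * (b + b + a) + (b * suc b + b)) ≤ 2 * n
  -- For b = 1 the estimate b² ≤ ab would be too weak, so b² is kept exact.
  room₂ (suc zero) _ _ n-large = begin
    2 * (2 + (d + d * 1)) + (2 * (1 + 1 + a) + (1 * 2 + 1)) ≡⟨ expand a d ⟩
    d * 4 + 11 + 2 * a               ≤⟨ +-monoˡ-≤ (2 * a) (+-mono-≤ 4d≤a (≤-trans (m≤m+n 11 13) 24≤a)) ⟩
    a + a + 2 * a                    ≤⟨ m≤m+n _ 2 ⟩
    a + a + 2 * a + 2                ≡⟨ collect a ⟩
    2 * (a + 1 + 1 * a)              ≤⟨ *-monoʳ-≤ 2 n-large ⟩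
    2 * n                            ∎
    where
    expand : ∀ a d → 2 * (2 + (d + d * 1)) + (2 * (1 + 1 + a) + (1 * 2 + 1)) ≡ d * 4 + 11 + 2 * a
    expand = solve-∀
    collect : ∀ a → a + a + 2 * a + 2 ≡ 2 * (a + 1 + 1 * a)
    collect = solve-∀
  -- Doubling produces the factor `d * 4`. The constant 24 comes from `24 + 8 * c ≤ a * (1 + c)` at
  -- c = 0.
  room₂ (suc (suc c)) _ b≤a n-large = *-cancelˡ-≤ 2 (begin
    2 * (2 * (2 + (d + d * e)) + (2 * (e + e + a) + (e * suc e + e)))
      ≡⟨ expand a c d ⟩
    (d * 4) * (3 + c) + 2 * (e * e) + (24 + 8 * c) + (4 * a + 4 * e)
      ≤⟨ +-monoˡ-≤ (4 * a + 4 * e) (+-mono-≤ (+-mono-≤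
           (*-monoˡ-≤ (3 + c) 4d≤a) (*-monoʳ-≤ 2 (*-monoʳ-≤ e b≤a)))
           (≤-trans (m≤m+n (24 + 8 * c) (16 * c))
             (≤-trans (≤-reflexive (scale c)) (*-monoˡ-≤ (1 + c) 24≤a)))) ⟩
    a * (3 + c) + 2 * (e * a) + a * (1 + c) + (4 * a + 4 * e)
      ≡⟨ collect a c ⟩
    2 * (2 * (a + e + e * a))
      ≤⟨ *-monoʳ-≤ 2 (*-monoʳ-≤ 2 n-large) ⟩
    2 * (2 * n) ∎)
    where
    e = suc (suc c)
    expand : ∀ a c d → let e = suc (suc c) in
      2 * (2 * (2 + (d + d * e)) + (2 * (e + e + a) + (e * suc e + e))) ≡
      (d * 4) * (3 + c) + 2 * (e * e) + (24 + 8 * c) + (4 * a + 4 * e)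
    expand = solve-∀
    scale : ∀ c → 24 + 8 * c + 16 * c ≡ 24 * (1 + c)
    scale = solve-∀
    collect : ∀ a c → let e = suc (suc c) in
      a * (3 + c) + 2 * (e * a) + a * (1 + c) + (4 * a + 4 * e) ≡ 2 * (2 * (a + e + e * a))
    collect = solve-∀

-- Every monomial is at most q = a². The two left sides are then at most 6q and 17q, against 10q and
-- 20q.
room-many-vertices : ∀ {n a b} → b ≤ a → 1 ≤ a → 10 * (a * a) ≤ n → Room n a b a
room-many-vertices {n} {a} {b} b≤a 1≤a many = room₁ , room₂
  where
  open ≤-Reasoning
  q = a * a
  a≤q : a ≤ q
  a≤q = ≤-trans (≤-reflexive (sym (*-identityʳ a))) (*-monoʳ-≤ a 1≤a)
  1≤q = ≤-trans 1≤a a≤q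
  b≤q = ≤-trans b≤a a≤q
  ba≤q : b * a ≤ q
  ba≤q = *-monoˡ-≤ a b≤a
  ab≤q : a * b ≤ q
  ab≤q = *-monoʳ-≤ a b≤a
  bb≤q : b * b ≤ q
  bb≤q = *-mono-≤ b≤a b≤a
  room₁ : 3 + (a + (b + b * a)) ≤ n
  room₁ = begin
    3 * 1 + (a + (b + b * a)) ≤⟨ +-mono-≤ (*-monoʳ-≤ 3 1≤q) (+-mono-≤ a≤q (+-mono-≤ b≤q ba≤q)) ⟩
    3 * q + (q + (q + q))     ≤⟨ m≤m+n _ (4 * q) ⟩
    3 * q + (q + (q + q)) + 4 * q ≡⟨ collect q ⟩
    10 * q                    ≤⟨ many ⟩
    n                         ∎
    where
    collect : ∀ q → 3 * q + (q + (q + q)) + 4 * q ≡ 10 * q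
    collect = solve-∀
  room₂ : 2 * (2 + (a + a * b)) + (2 * (b + b + a) + (b * suc b + b)) ≤ 2 * n
  room₂ = begin
    2 * (2 * 1 + (a + a * b)) + (2 * (b + b + a) + (b * suc b + b))
      ≡⟨ cong (λ t → 2 * (2 * 1 + (a + a * b)) + (2 * (b + b + a) + (t + b))) (*-suc b b) ⟩
    2 * (2 * 1 + (a + a * b)) + (2 * (b + b + a) + (b + b * b + b))
      ≤⟨ +-mono-≤ (*-monoʳ-≤ 2 (+-mono-≤ (*-monoʳ-≤ 2 1≤q) (+-mono-≤ a≤q ab≤q)))
           (+-mono-≤ (*-monoʳ-≤ 2 (+-mono-≤ (+-mono-≤ b≤q b≤q) a≤q))
             (+-mono-≤ (+-mono-≤ b≤q bb≤q) b≤q)) ⟩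
    2 * (2 * q + (q + q)) + (2 * (q + q + q) + (q + q + q)) ≤⟨ m≤m+n _ (3 * q) ⟩
    2 * (2 * q + (q + q)) + (2 * (q + q + q) + (q + q + q)) + 3 * q ≡⟨ collect q ⟩
    2 * (10 * q)              ≤⟨ *-monoʳ-≤ 2 many ⟩
    2 * n                     ∎
    where
    collect : ∀ q → 2 * (2 * q + (q + q)) + (2 * (q + q + q) + (q + q + q)) + 3 * q ≡ 2 * (10 * q)
    collect = solve-∀

-- Since a ≤ 5d, the left side is at most 250d², and 250 ≤ d - 1.
square-≤-cube : ∀ {a d} → a < d * 4 + 4 → 252 ≤ d → 10 * (a * a) ≤ suc d * ((d ∸ 1) * d)
square-≤-cube {a} {d} a< large = begin
  10 * (a * a)             ≤⟨ *-monoʳ-≤ 10 (*-mono-≤ a≤5d a≤5d) ⟩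
  10 * ((d * 4 + d) * (d * 4 + d)) ≡⟨ collect d ⟩
  d * (250 * d)            ≤⟨ *-mono-≤ (n≤1+n d) (*-monoˡ-≤ d (≤-trans (n≤1+n 250) (∸-monoˡ-≤ 1 large))) ⟩
  suc d * ((d ∸ 1) * d)    ∎
  where
  open ≤-Reasoning
  a≤5d : a ≤ d * 4 + d
  a≤5d = ≤-trans (<⇒≤ a<) (+-monoʳ-≤ (d * 4) (≤-trans (m≤m+n 4 248) large))
  collect : ∀ d → 10 * ((d * 4 + d) * (d * 4 + d)) ≡ d * (250 * d)
  collect = solve-∀

-- Combining the regime of many vertices with the regime of low degeneracy

theorem1 : ∀ (n : ℕ) (G₁ G₂ : Graph n) →
    maxDegree G₁ ≥ maxDegree G₂ →
    suc (maxDegree G₁) * suc (maxDegree G₂) ≤ suc n →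
    ¬ ContainsCycle G₁ 4 → ¬ ContainsCycle G₁ 6 → ¬ ContainsCycle G₁ 8 →
    ¬ ContainsCycle G₂ 4 → ¬ ContainsCycle G₂ 6 → ¬ ContainsCycle G₂ 8 →
    (maxDegree G₁ ≥ 940060 ⊎ (maxDegree G₁ ≥ maxDegree G₂ × maxDegree G₂ ≥ 27620)) →
    Pack G₁ G₂
theorem1 n G₁ G₂ b≤a size G4 G6 G8 R4 _ _ large with 1 ≤? maxDegree G₂
-- Here `G₂` has no edges, so the identity placements work.
... | no b≡0 = id , id , id , id , λ _ _ x y _ e _ →
  b≡0 (≤-trans (∈-length (∈-nbrs⁺ G₂ e)) (length-nbrs-≤ G₂ x))
... | yes 1≤b = pack low
  where
  open Insertion G₁ G₂ G4 G6 G8 R4 (length-nbrs-≤ G₁) (length-nbrs-≤ G₂)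
  a = maxDegree G₁
  b = maxDegree G₂
  d = a / 4
  -- As 1008 = 4 · 252, this gives d ≥ 252 for `square-≤-cube`.
  1008≤a : 1008 ≤ a
  1008≤a = Sum.[ ≤-trans (≤ᵇ⇒≤ 1008 940060 _)
               , (λ (_ , b-large) → ≤-trans (≤ᵇ⇒≤ 1008 27620 _) (≤-trans b-large b≤a)) ]′ large
  252≤d : 252 ≤ d
  252≤d = /-monoˡ-≤ 4 1008≤a
  a<4d+4 : a < d * 4 + 4
  a<4d+4 = subst (_< d * 4 + 4) (trans (+-comm (d * 4) (a % 4)) (sym (m≡m%n+[m/n]*n a 4)))
    (+-monoʳ-< (d * 4) (m%n<n a 4))
  low : LowDegree
  -- If n reaches the cubic bound, then n ≥ 10a² and any r in `S` serves with δ = a. Otherwise some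
  -- vertex of `S` has degree at most d = a / 4.
  low S {r} r∈ with suc d * ((d ∸ 1) * d) ≤? n
  ... | yes many = r , r∈ , a ,
    ≤-trans (length-nbrs-map-≤ (induced G₁ S) G₁ id id (proj₁ ∘ induced⁻ G₁ S) r) (length-nbrs-≤ G₁ r) ,
    room-many-vertices b≤a (≤-trans 1≤b b≤a) (≤-trans (square-≤-cube a<4d+4 252≤d) many)
  ... | no few = let u , u∈ , du = low-degree-vertex (≰⇒> few) S r∈ in
    u , u∈ , d , du ,
    room-low-degree 1≤b b≤a (≤-trans (≤ᵇ⇒≤ 24 1008 _) 1008≤a)
      (≤-trans (≤ᵇ⇒≤ 1 252 _) 252≤d) (m/n*n≤m a 4) size
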